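{- There is no regular Steinhaus graph of odd degree on $n$ vertices for any $n$ with $2<n\leq 1500$.
   Context: A Steinhaus matrix of size $n\geq1$ is a matrix $M=(a_{i,j})_{1\leq i,j\leq n}$ with entries in $\mathbb{F}_2=\{0,1\}$ such that $a_{i,i}=0$ for all $i$, $a_{i,j}=a_{i-1,j-1}+a_{i-1,j}$ (addition in $\mathbb{F}_2$) for all $2\leq i<j\leq n$, and $a_{i,j}=a_{j,i}$ for all $i,j$. A Steinhaus graph is a simple graph on labelled vertices $V_1,\ldots,V_n$ whose adjacency matrix is a Steinhaus matrix. -}

module Defs where

open import Data.Bool using (Bool; true; false; _xor_; if_then_else_)
open import Data.Nat using (ℕ; suc; _<_)
open import Data.Fin using (Fin; toℕ)
open import Data.List using (List; map; allFin)
open import Data.Nat.ListAction using (sum)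
open import Data.Product using (_×_)
open import Relation.Binary.PropositionalEquality using (_≡_)

-- A square F₂-matrix of size n (F₂ = Bool, addition = xor), indices 0-based.
Matrix : ℕ → Set
Matrix n = Fin n → Fin n → Bool

-- Steinhaus matrix: zero diagonal; a(i,j) = a(i-1,j-1) + a(i-1,j) for 2 ≤ i < j ≤ n
-- (1-based), i.e. for 0-based indices i < j with i = i'+1, j = j'+1; symmetric.
record IsSteinhaus {n : ℕ} (M : Matrix n) : Set where
  field
    diag : ∀ (i : Fin n) → M i i ≡ false
    rule : ∀ (i j i′ j′ : Fin n) → toℕ i ≡ suc (toℕ i′) → toℕ j ≡ suc (toℕ j′) →
           toℕ i < toℕ j → M i j ≡ (M i′ j′ xor M i′ j)
    symm : ∀ (i j : Fin n) → M i j ≡ M j i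

degree : {n : ℕ} → Matrix n → Fin n → ℕ
degree {n} M i = sum (map (λ j → if M i j then 1 else 0) (allFin n))

IsRegular : {n : ℕ} → Matrix n → ℕ → Set
IsRegular {n} M d = ∀ (i : Fin n) → degree M i ≡ d

{-# OPTIONS --safe #-}
-- Writing the entries above the diagonal as a(i,j,k) with i + j + k = n − 2, the Steinhaus rule
-- becomes a(i+1,j,k) + a(i,j+1,k) + a(i,j,k+1) = 0, which is invariant under permuting coordinates.
-- If all degrees are odd, n is even, and the degree parities telescope to a relation along the border
-- which propagates into the triangle and shows that deleting the first and last vertices leaves a
-- reflection-symmetric triangle.  Comparing the degrees of two mirror vertices as integers, the
-- first row is then a palindrome too, so the inner triangle is invariant under all of S₃ and
-- the inner graph is regular of degree n/2 − 1.  Its rows are palindromes with centre 0, so a degree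
-- is twice a sum over half rows, and the parities of these sums telescope: regularity modulo 4 is
-- linear over F₂.  The triangle is determined by its entries γ next to a symmetry axis, through
-- Fibonacci polynomials Fₘ applied to γ as linear forms, and the linear conditions become
--   γ p = F₂ₚ₊₁ γ   and   γ (L − 1 − p) = F₂ₚ γ   for 0 ≤ p < L = n/2 − 3 ≡ 2 (mod 4).
-- For L ≤ 746 Gaussian elimination leaves only γ = 0, so the inner graph has no edges, although its
-- degree n/2 − 1 is positive.
module Submission where

open import Defs
open import Data.Bool using (Bool; true; false; _xor_; not; if_then_else_; _∧_) renaming (T to IsTrue)
open import Data.Bool.Properties
  using (xor-assoc; xor-comm; xor-same; xor-identityʳ; not-involutive; T-≡)
open import Data.Empty using (⊥; ⊥-elim)
open import Data.Fin using (Fin; toℕ; fromℕ<)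
open import Data.Fin.Properties using (toℕ<n; toℕ-fromℕ<; fromℕ<-toℕ)
open import Data.List using (List; []; _∷_; map; length; tabulate)
open import Data.List.Properties using (map-tabulate)
open import Data.List.Relation.Unary.All using (All; []; _∷_)
open import Data.Nat
open import Data.Nat.ListAction using () renaming (sum to listSum)
open import Data.Nat.Properties
open import Data.Nat.Tactic.RingSolver using (solve-∀)
open import Data.Product using (Σ; ∃; _×_; _,_; proj₁; proj₂)
open import Data.Sum using (inj₁; inj₂)
open import Data.Unit using (⊤; tt)
open import Function using (_∘_; id)
open import Function.Bundles using (Equivalence)
open import Relation.Nullary using (¬_; yes; no; contradiction)
open import Relation.Binary.PropositionalEquality
  using (_≡_; refl; sym; trans; cong; cong₂; subst; subst₂; module ≡-Reasoning)

-- Gaussian elimination over F₂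

-- A linear form over F₂ in unknowns γ 0, γ 1, …: the descending list of its indices.
Form : Set
Form = List ℕ

infixr 6 _⊕_
mutual
  _⊕_ : Form → Form → Form
  [] ⊕ e = e
  (i ∷ d) ⊕ e = merge i d e

  -- This is `(i ∷ d) ⊕ e` with the head kept apart, so that every recursive call shrinks a list
  -- structurally.
  merge : ℕ → Form → Form → Form
  merge i d [] = i ∷ d
  merge i d (j ∷ e) =
    if i ≡ᵇ j then d ⊕ e else
    if j <ᵇ i then i ∷ (d ⊕ (j ∷ e)) else
    j ∷ merge i d e

reduce : Form → List Form → Form
reduce [] ps = []
reduce (i ∷ d) [] = i ∷ d
reduce (i ∷ d) ([] ∷ ps) = reduce (i ∷ d) ps
reduce (i ∷ d) ((j ∷ q) ∷ ps) =
  if i ≡ᵇ j then reduce (d ⊕ q) ps else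
  if j <ᵇ i then i ∷ reduce d ((j ∷ q) ∷ ps) else
  reduce (i ∷ d) ps

place : Form → List Form → List Form
place [] ps = ps
place (i ∷ d) [] = (i ∷ d) ∷ []
place (i ∷ d) ([] ∷ ps) = place (i ∷ d) ps
place (i ∷ d) ((j ∷ q) ∷ ps) =
  if i <ᵇ j then (j ∷ q) ∷ place (i ∷ d) ps else
  (i ∷ d) ∷ (j ∷ q) ∷ ps

insert : Form → List Form → List Form
insert e ps = place (reduce e ps) ps

below : ℕ → Form → Bool
below l [] = true
below l (i ∷ d) = (i <ᵇ l) ∧ below l d

triangular : ℕ → List Form → Bool
triangular zero ps = true
triangular (suc l) [] = false
triangular (suc l) ([] ∷ ps) = false
triangular (suc l) ((i ∷ d) ∷ ps) = (i ≡ᵇ l) ∧ (below l d ∧ triangular l ps)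

-- The Fibonacci polynomials mod 2: if s² = rs + w then sᵐ = Fₘ s + Fₘ₋₁ w, where fib m lists the
-- exponents of w in Fₘ.
fib : ℕ → Form
fib zero = []
fib (suc zero) = 0 ∷ []
fib (suc (suc m)) = fib (suc m) ⊕ map suc (fib m)

-- evens n (fib m) (fib (suc m)) lists fib m, fib (2 + m), …; carrying two terms along shares the work.
mutual
  evens : ℕ → Form → Form → List Form
  evens zero a b = []
  evens (suc n) a b = a ∷ odds n b (b ⊕ map suc a)

  odds : ℕ → Form → Form → List Form
  odds n a b = evens n b (b ⊕ map suc a)

-- Adds the equations γ i = e, γ (i ∸ 1) = e′, … for es = e ∷ e′ ∷ … until L pivots are found.
solve : ℕ → ℕ → List Form → List Form → Bool
solve L i es ps = if length ps ≡ᵇ L then triangular L ps else next i es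
  where
  next : ℕ → List Form → Bool
  next zero es = false
  next (suc i) [] = false
  next (suc i) (e ∷ es) = solve L i es (insert ((i ∷ []) ⊕ e) ps)

-- The equations γ p = o listed by os do not depend on L, so a single pass serves all L = 2, 6, 10, ….
mutual
  run : ℕ → ℕ → List Form → List Form → List Form → Bool
  run zero p es os ps = true
  run (suc n) p es (o₀ ∷ o₁ ∷ os) ps =
    check n p es os (insert ((suc p ∷ []) ⊕ o₁) (insert ((p ∷ []) ⊕ o₀) ps))
  run (suc n) p es _ ps = false

  check : ℕ → ℕ → List Form → List Form → List Form → Bool
  check n p es (o₂ ∷ o₃ ∷ os) ps =
    -- When the run starts from `p = 0`, `ps` now holds the consequences of all equations `γ j = o`
    -- with `j < 2 + p`; `es` supplies the second family for `L = 2 + p`.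
    solve (2 + p) (2 + p) es ps ∧
    run n (4 + p) es os (insert ((3 + p ∷ []) ⊕ o₃) (insert ((2 + p ∷ []) ⊕ o₂) ps))
  check n p es _ ps = false


-- Soundness of the elimination

⟦_⟧ : Form → (ℕ → Bool) → Bool
⟦ [] ⟧ γ = false
⟦ i ∷ d ⟧ γ = γ i xor ⟦ d ⟧ γ

xor-cancelˡ : ∀ a b → a xor (a xor b) ≡ b
xor-cancelˡ false b = refl
xor-cancelˡ true false = refl
xor-cancelˡ true true = refl

xor-leftComm : ∀ a b c → a xor (b xor c) ≡ b xor (a xor c)
xor-leftComm a b c = trans (sym (xor-assoc a b c)) (trans (cong (_xor c) (xor-comm a b)) (xor-assoc b a c))

≡true⇒IsTrue : ∀ {b} → b ≡ true → IsTrue b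
≡true⇒IsTrue = Equivalence.from T-≡

∧-true : ∀ {a b} → a ∧ b ≡ true → a ≡ true × b ≡ true
∧-true {true} {true} eq = refl , refl

module _ (γ : ℕ → Bool) where

  private
    ⟦_⟧ᵧ : Form → Bool
    ⟦ e ⟧ᵧ = ⟦ e ⟧ γ

  Vanish : List Form → Set
  Vanish = All (λ e → ⟦ e ⟧ᵧ ≡ false)

  mutual
    ⟦⊕⟧ : ∀ d e → ⟦ d ⊕ e ⟧ᵧ ≡ ⟦ d ⟧ᵧ xor ⟦ e ⟧ᵧ
    ⟦⊕⟧ [] e = refl
    ⟦⊕⟧ (i ∷ d) e = ⟦merge⟧ i d e

    ⟦merge⟧ : ∀ i d e → ⟦ merge i d e ⟧ᵧ ≡ (γ i xor ⟦ d ⟧ᵧ) xor ⟦ e ⟧ᵧ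
    ⟦merge⟧ i d [] = xor-comm false _
    ⟦merge⟧ i d (j ∷ e) with i ≡ᵇ j in eq
    ... | true rewrite ≡ᵇ⇒≡ i j (≡true⇒IsTrue eq) | ⟦⊕⟧ d e = begin
      ⟦ d ⟧ᵧ xor ⟦ e ⟧ᵧ                             ≡⟨ cong (⟦ d ⟧ᵧ xor_) (xor-cancelˡ (γ j) _) ⟨
      ⟦ d ⟧ᵧ xor (γ j xor (γ j xor ⟦ e ⟧ᵧ))         ≡⟨ xor-leftComm ⟦ d ⟧ᵧ (γ j) _ ⟩
      γ j xor (⟦ d ⟧ᵧ xor (γ j xor ⟦ e ⟧ᵧ))         ≡⟨ xor-assoc (γ j) _ _ ⟨
      (γ j xor ⟦ d ⟧ᵧ) xor (γ j xor ⟦ e ⟧ᵧ)         ∎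
      where open ≡-Reasoning
    ... | false with j <ᵇ i
    ... | true rewrite ⟦⊕⟧ d (j ∷ e) = sym (xor-assoc (γ i) _ _)
    ... | false rewrite ⟦merge⟧ i d e = xor-leftComm (γ j) (γ i xor ⟦ d ⟧ᵧ) ⟦ e ⟧ᵧ

  ⟦reduce⟧-step : ∀ i d j q ps → ⟦ j ∷ q ⟧ᵧ ≡ false →
                  ⟦ reduce (d ⊕ q) ps ⟧ᵧ ≡ ⟦ d ⊕ q ⟧ᵧ →
                  ⟦ reduce d ((j ∷ q) ∷ ps) ⟧ᵧ ≡ ⟦ d ⟧ᵧ →
                  ⟦ reduce (i ∷ d) ps ⟧ᵧ ≡ ⟦ i ∷ d ⟧ᵧ →
                  ⟦ reduce (i ∷ d) ((j ∷ q) ∷ ps) ⟧ᵧ ≡ ⟦ i ∷ d ⟧ᵧ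
  -- Abstracting `≡ᵇ⇒≡ i j` together with the test makes it yield `i ≡ j` from `tt` in the first
  -- case.
  ⟦reduce⟧-step i d j q ps z eq₁ eq₂ eq₃ with i ≡ᵇ j | ≡ᵇ⇒≡ i j | j <ᵇ i
  ... | true | i≡j | _ = begin
    ⟦ reduce (d ⊕ q) ps ⟧ᵧ                  ≡⟨ eq₁ ⟩
    ⟦ d ⊕ q ⟧ᵧ                              ≡⟨ ⟦⊕⟧ d q ⟩
    -- Adding `γ j` twice completes `q` to the pivot row `j ∷ q`, which vanishes by `z`.
    ⟦ d ⟧ᵧ xor ⟦ q ⟧ᵧ                       ≡⟨ xor-cancelˡ (γ j) _ ⟨
    γ j xor (γ j xor (⟦ d ⟧ᵧ xor ⟦ q ⟧ᵧ))   ≡⟨ cong (γ j xor_) (xor-leftComm (γ j) ⟦ d ⟧ᵧ _) ⟩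
    γ j xor (⟦ d ⟧ᵧ xor (γ j xor ⟦ q ⟧ᵧ))   ≡⟨ cong (λ b → γ j xor (⟦ d ⟧ᵧ xor b)) z ⟩
    γ j xor (⟦ d ⟧ᵧ xor false)              ≡⟨ cong₂ _xor_ (cong γ (sym (i≡j tt))) (xor-comm ⟦ d ⟧ᵧ false) ⟩
    γ i xor ⟦ d ⟧ᵧ                          ∎
    where open ≡-Reasoning
  ... | false | _ | true = cong (γ i xor_) eq₂
  ... | false | _ | false = eq₃

  ⟦reduce⟧ : ∀ e ps → Vanish ps → ⟦ reduce e ps ⟧ᵧ ≡ ⟦ e ⟧ᵧ
  ⟦reduce⟧ [] ps v = refl
  ⟦reduce⟧ (i ∷ d) [] v = refl
  ⟦reduce⟧ (i ∷ d) ([] ∷ ps) (_ ∷ v) = ⟦reduce⟧ (i ∷ d) ps v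
  ⟦reduce⟧ (i ∷ d) ((j ∷ q) ∷ ps) (z ∷ v) =
    ⟦reduce⟧-step i d j q ps z (⟦reduce⟧ (d ⊕ q) ps v)
      (⟦reduce⟧ d ((j ∷ q) ∷ ps) (z ∷ v)) (⟦reduce⟧ (i ∷ d) ps v)

  place-vanish : ∀ e ps → ⟦ e ⟧ᵧ ≡ false → Vanish ps → Vanish (place e ps)
  place-vanish [] ps z v = v
  place-vanish (i ∷ d) [] z v = z ∷ []
  place-vanish (i ∷ d) ([] ∷ ps) z (_ ∷ v) = place-vanish (i ∷ d) ps z v
  place-vanish (i ∷ d) ((j ∷ q) ∷ ps) z (y ∷ v) with i <ᵇ j
  ... | true = y ∷ place-vanish (i ∷ d) ps z v
  ... | false = z ∷ y ∷ v

  insert-vanish : ∀ i e ps → γ i ≡ ⟦ e ⟧ᵧ → Vanish ps → Vanish (insert ((i ∷ []) ⊕ e) ps)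
  insert-vanish i e ps eq v = place-vanish (reduce ((i ∷ []) ⊕ e) ps) ps (begin
    ⟦ reduce ((i ∷ []) ⊕ e) ps ⟧ᵧ   ≡⟨ ⟦reduce⟧ ((i ∷ []) ⊕ e) ps v ⟩
    ⟦ (i ∷ []) ⊕ e ⟧ᵧ               ≡⟨ ⟦⊕⟧ (i ∷ []) e ⟩
    (γ i xor false) xor ⟦ e ⟧ᵧ      ≡⟨ cong (_xor ⟦ e ⟧ᵧ) (trans (xor-comm (γ i) false) eq) ⟩
    ⟦ e ⟧ᵧ xor ⟦ e ⟧ᵧ               ≡⟨ xor-same ⟦ e ⟧ᵧ ⟩
    false                           ∎) v
    where open ≡-Reasoning

  below-vanish : ∀ l d → below l d ≡ true → (∀ j → j < l → γ j ≡ false) → ⟦ d ⟧ᵧ ≡ false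
  below-vanish l [] b z = refl
  below-vanish l (i ∷ d) b z with ∧-true {i <ᵇ l} b
  ... | i<l , b′ rewrite z i (<ᵇ⇒< i l (≡true⇒IsTrue i<l)) = below-vanish l d b′ z

  -- Back substitution: apart from its pivot, each row involves only smaller unknowns, which vanish
  -- by induction.
  triangular-vanish : ∀ l ps → triangular l ps ≡ true → Vanish ps → ∀ j → j < l → γ j ≡ false
  triangular-vanish (suc l) ((i ∷ d) ∷ ps) t (z ∷ v) j j<1+l with ∧-true {i ≡ᵇ l} t
  ... | i≡l , t′ with ∧-true {below l d} t′
  ... | b , t″ with m≤n⇒m<n∨m≡n (≤-pred j<1+l)
  ... | inj₁ j<l = triangular-vanish l ps t″ v j j<l
  ... | inj₂ refl with ≡ᵇ⇒≡ i j (≡true⇒IsTrue i≡l)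
  ... | refl rewrite below-vanish l d b (triangular-vanish l ps t″ v) = trans (xor-comm false (γ j)) z

  -- Either the index or the list may run out first, so one precomputed list serves every `L`. The
  -- same holds for `Up`.
  Down : ℕ → List Form → Set
  Down zero es = ⊤
  Down (suc i) [] = ⊤
  Down (suc i) (e ∷ es) = γ i ≡ ⟦ e ⟧ᵧ × Down i es

  Up : ℕ → ℕ → List Form → Set
  Up zero p os = ⊤
  Up (suc m) p [] = ⊤
  Up (suc m) p (o ∷ os) = γ p ≡ ⟦ o ⟧ᵧ × Up m (suc p) os

  solve-vanish : ∀ L i es ps → solve L i es ps ≡ true → Down i es → Vanish ps →
                 ∀ j → j < L → γ j ≡ false
  solve-vanish L i es ps s ds v with length ps ≡ᵇ L
  ... | true = triangular-vanish L ps s v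
  solve-vanish L (suc i) (e ∷ es) ps s (d , ds) v | false =
    solve-vanish L i es _ s ds (insert-vanish i e ps d v)

  mutual
    -- `k` counts the rounds left before size `L = 2 + k * 4 + p` is tested; each round lowers `k`
    -- by 1 and raises `p` by 4, which preserves `L`.
    run-vanish : ∀ n k p es os ps → run n p es os ps ≡ true → k < n →
                 Down (2 + k * 4 + p) es → Up (2 + k * 4) p os → Vanish ps →
                 ∀ j → j < 2 + k * 4 + p → γ j ≡ false
    run-vanish (suc n) k p es (o₀ ∷ o₁ ∷ os) ps r k<n ds (u₀ , u₁ , us) v =
      check-vanish n k p es os _ r k<n ds us
        (insert-vanish (suc p) o₁ _ u₁ (insert-vanish p o₀ ps u₀ v))

    check-vanish : ∀ n k p es os ps → check n p es os ps ≡ true → k < suc n →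
                   Down (2 + k * 4 + p) es → Up (k * 4) (2 + p) os → Vanish ps →
                   ∀ j → j < 2 + k * 4 + p → γ j ≡ false
    check-vanish n zero p es (o₂ ∷ o₃ ∷ os) ps c k<n ds us v =
      solve-vanish (2 + p) (2 + p) es ps (proj₁ (∧-true c)) ds v
    check-vanish n (suc k) p es (o₂ ∷ o₃ ∷ os) ps c (s<s k<n) ds (u₂ , u₃ , us) v =
      subst (λ L → ∀ j → j < L → γ j ≡ false) eq
        (run-vanish n k (4 + p) es os _ (proj₂ (∧-true {solve (2 + p) (2 + p) es ps} c)) k<n
          (subst (λ L → Down L es) (sym eq) ds) us
          (insert-vanish (3 + p) o₃ _ u₃ (insert-vanish (2 + p) o₂ ps u₂ v)))
      where
      eq : 2 + k * 4 + (4 + p) ≡ 2 + suc k * 4 + p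
      eq = cong (2 +_) (trans (sym (+-assoc (k * 4) 4 p)) (cong (_+ p) (+-comm (k * 4) 4)))

-- Fibonacci polynomials as linear forms

⟦⟧-cong : ∀ e {γ δ : ℕ → Bool} → (∀ j → γ j ≡ δ j) → ⟦ e ⟧ γ ≡ ⟦ e ⟧ δ
⟦⟧-cong [] eq = refl
⟦⟧-cong (i ∷ d) eq = cong₂ _xor_ (eq i) (⟦⟧-cong d eq)

⟦map-suc⟧ : ∀ e γ → ⟦ map suc e ⟧ γ ≡ ⟦ e ⟧ (γ ∘ suc)
⟦map-suc⟧ [] γ = refl
⟦map-suc⟧ (i ∷ d) γ = cong (γ (suc i) xor_) (⟦map-suc⟧ d γ)

-- Multiplication by `w` acts on the unknowns as the shift `γ ∘ suc`.
⟦fib⟧ : ∀ m γ → ⟦ fib (2 + m) ⟧ γ ≡ ⟦ fib (1 + m) ⟧ γ xor ⟦ fib m ⟧ (γ ∘ suc)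
⟦fib⟧ m γ = trans (⟦⊕⟧ γ (fib (suc m)) _) (cong (⟦ fib (suc m) ⟧ γ xor_) (⟦map-suc⟧ (fib m) γ))

-- All exponents in `Fₘ` are smaller than `m / 2`.
⟦fib⟧-zero : ∀ m γ → (∀ j → j * 2 < m → γ j ≡ false) → ⟦ fib m ⟧ γ ≡ false
⟦fib⟧-zero zero γ z = refl
⟦fib⟧-zero (suc zero) γ z = trans (xor-identityʳ (γ 0)) (z 0 z<s)
⟦fib⟧-zero (suc (suc m)) γ z = trans (⟦fib⟧ m γ) (cong₂ _xor_
  (⟦fib⟧-zero (suc m) γ (λ j lt → z j (m<n⇒m<1+n lt)))
  (⟦fib⟧-zero m (γ ∘ suc) (λ j lt → z (suc j) (s<s (s<s lt)))))

module _ (γ : ℕ → Bool) (L : ℕ)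
  (ups : ∀ p → p < L → γ p ≡ ⟦ fib (suc (p * 2)) ⟧ γ)
  (downs : ∀ q j → suc (q + j) ≡ L → γ j ≡ ⟦ fib (q * 2) ⟧ γ) where

  evens-down : ∀ n q i → q + i ≡ L → Down γ i (evens n (fib (q * 2)) (fib (suc (q * 2))))
  evens-down n q zero eq = tt
  evens-down zero q (suc i) eq = tt
  evens-down (suc n) q (suc i) eq =
    downs q i (trans (sym (+-suc q i)) eq) , evens-down n (suc q) i (trans (sym (+-suc q i)) eq)

  odds-up : ∀ n p m → p + m ≡ L → Up γ m p (evens n (fib (suc (p * 2))) (fib (suc p * 2)))
  odds-up n p zero eq = tt
  odds-up zero p (suc m) eq = tt
  odds-up (suc n) p (suc m) eq =
    ups p (subst (p <_) eq (m<m+n p z<s)) , odds-up n (suc p) m (trans (sym (+-suc p m)) eq)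

  -- A successful run tests `L = 2 + k * 4` in its round `k`, counted from 0, with exactly the two
  -- families of equations assumed here.
  rigid : ∀ m n k → k < m → 2 + k * 4 ≡ L →
          run m 0 (evens n (fib 0) (fib 1)) (evens n (fib 1) (fib 2)) [] ≡ true →
          ∀ j → j < L → γ j ≡ false
  rigid m n k k<m eq checked j j<L = run-vanish γ m k 0 _ _ [] checked k<m
    (subst (λ i → Down γ i (evens n (fib 0) (fib 1))) L≡ (evens-down n 0 L refl))
    (subst (λ i → Up γ i 0 (evens n (fib 1) (fib 2))) (sym eq) (odds-up n 0 L refl))
    [] j (subst (j <_) L≡ j<L)
    where
    L≡ : L ≡ 2 + k * 4 + 0
    L≡ = sym (trans (+-identityʳ (2 + k * 4)) eq)

-- Counting and parity

bit : Bool → ℕ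
bit b = if b then 1 else 0

count : (ℕ → Bool) → ℕ → ℕ
count f zero = 0
count f (suc n) = bit (f 0) + count (f ∘ suc) n

xsum : (ℕ → Bool) → ℕ → Bool
xsum f zero = false
xsum f (suc n) = f 0 xor xsum (f ∘ suc) n

odd : ℕ → Bool
odd zero = false
odd (suc n) = not (odd n)

odd-+ : ∀ m n → odd (m + n) ≡ odd m xor odd n
odd-+ zero n = refl
odd-+ (suc m) n = trans (cong not (odd-+ m n)) (not-xor (odd m) (odd n))
  where
  not-xor : ∀ a b → not (a xor b) ≡ not a xor b
  not-xor false b = refl
  not-xor true b = not-involutive b

odd-bit : ∀ b → odd (bit b) ≡ b
odd-bit false = refl
odd-bit true = refl

odd-count : ∀ f n → odd (count f n) ≡ xsum f n
odd-count f zero = refl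
odd-count f (suc n) = trans (odd-+ (bit (f 0)) _) (cong₂ _xor_ (odd-bit (f 0)) (odd-count (f ∘ suc) n))

count-cong : ∀ {f g} n → (∀ k → k < n → f k ≡ g k) → count f n ≡ count g n
count-cong zero eq = refl
count-cong (suc n) eq = cong₂ _+_ (cong bit (eq 0 z<s)) (count-cong n (λ k k<n → eq (suc k) (s<s k<n)))

xsum-cong : ∀ {f g} n → (∀ k → k < n → f k ≡ g k) → xsum f n ≡ xsum g n
xsum-cong zero eq = refl
xsum-cong (suc n) eq = cong₂ _xor_ (eq 0 z<s) (xsum-cong n (λ k k<n → eq (suc k) (s<s k<n)))

count-+ : ∀ f m n → count f (m + n) ≡ count f m + count (λ k → f (m + k)) n
count-+ f zero n = refl
count-+ f (suc m) n = trans (cong (bit (f 0) +_) (count-+ (f ∘ suc) m n)) (sym (+-assoc (bit (f 0)) _ _))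

count-last : ∀ f n → count f (suc n) ≡ count f n + bit (f n)
count-last f zero = +-comm (bit (f 0)) 0
count-last f (suc n) = trans (cong (bit (f 0) +_) (count-last (f ∘ suc) n)) (sym (+-assoc (bit (f 0)) _ _))

-- The reflection `k ↦ n − 1 − k` is expressed as the relation `suc (k + l) ≡ n`, which avoids
-- truncated subtraction.
count-reverse : ∀ {f g} n → (∀ k l → suc (k + l) ≡ n → f k ≡ g l) → count f n ≡ count g n
count-reverse zero eq = refl
count-reverse {f} {g} (suc n) eq = begin
  bit (f 0) + count (f ∘ suc) n
    ≡⟨ cong₂ _+_ (cong bit (eq 0 n refl)) (count-reverse n (λ k l e → eq (suc k) l (cong suc e))) ⟩
  bit (g n) + count g n           ≡⟨ +-comm (bit (g n)) _ ⟩
  count g n + bit (g n)           ≡⟨ count-last g n ⟨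
  count g (suc n)                 ∎
  where open ≡-Reasoning

xsum-telescope : ∀ f n → xsum (λ k → f k xor f (suc k)) n ≡ f 0 xor f n
xsum-telescope f zero = sym (xor-same (f 0))
xsum-telescope f (suc n) = begin
  (f 0 xor f 1) xor xsum (λ k → f (suc k) xor f (2 + k)) n   ≡⟨ cong ((f 0 xor f 1) xor_) (xsum-telescope (f ∘ suc) n) ⟩
  (f 0 xor f 1) xor (f 1 xor f (suc n))                      ≡⟨ xor-assoc (f 0) _ _ ⟩
  f 0 xor (f 1 xor (f 1 xor f (suc n)))                      ≡⟨ cong (f 0 xor_) (xor-cancelˡ (f 1) _) ⟩
  f 0 xor f (suc n)                                          ∎
  where open ≡-Reasoning

Palindromic : (ℕ → Bool) → ℕ → Set
Palindromic f n = ∀ k l → suc (k + l) ≡ n → f k ≡ f l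

count-palindrome-even : ∀ f h → Palindromic f (h + h) → count f (h + h) ≡ count f h + count f h
count-palindrome-even f h pal = trans (count-+ f h h) (cong (count f h +_) (sym (count-reverse h
  (λ k l e → pal k (h + l) (trans (shuffle k h l) (cong (h +_) e))))))
  where
  shuffle : ∀ k h l → suc (k + (h + l)) ≡ h + suc (k + l)
  shuffle = solve-∀

count-palindrome-odd : ∀ f h → Palindromic f (suc (h + h)) →
                       count f (suc (h + h)) ≡ bit (f h) + (count f h + count f h)
count-palindrome-odd f h pal = begin
  count f (suc (h + h))                                     ≡⟨ cong (count f) (+-suc h h) ⟨
  count f (h + suc h)                                       ≡⟨ count-+ f h (suc h) ⟩
  count f h + (bit (f (h + 0)) + count (λ k → f (h + suc k)) h)
    ≡⟨ cong₂ (λ x y → count f h + (bit (f x) + y)) (+-identityʳ h)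
         (sym (count-reverse h (λ k l e → pal k (h + suc l) (trans (shuffle k h l) (cong (λ x → suc (h + x)) e))))) ⟩
  count f h + (bit (f h) + count f h)                       ≡⟨ swap (count f h) (bit (f h)) ⟩
  bit (f h) + (count f h + count f h)                       ∎
  where
  open ≡-Reasoning
  shuffle : ∀ k h l → suc (k + (h + suc l)) ≡ suc (h + suc (k + l))
  shuffle = solve-∀
  swap : ∀ x y → x + (y + x) ≡ y + (x + x)
  swap = solve-∀

odd-double : ∀ n → odd (n + n) ≡ false
odd-double n = trans (odd-+ n n) (xor-same (odd n))

double-injective : ∀ {m n} → m + m ≡ n + n → m ≡ n
double-injective {zero} {zero} eq = refl
double-injective {suc m} {suc n} eq =
  cong suc (double-injective (suc-injective (suc-injective
    (trans (sym (cong suc (+-suc m m))) (trans eq (cong suc (+-suc n n)))))))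

even⇒double : ∀ n → odd n ≡ false → ∃ λ m → n ≡ m + m
even⇒double zero eq = 0 , refl
even⇒double (suc (suc n)) eq with even⇒double n (trans (sym (not-involutive (odd n))) eq)
... | m , refl = suc m , cong suc (sym (+-suc m m))

xor-moveʳ : ∀ a b c → a ≡ b xor c → c ≡ a xor b
xor-moveʳ a b c eq = trans (trans (sym (xor-cancelˡ b c)) (cong (b xor_) (sym eq))) (xor-comm b a)

count-zero : ∀ f n → (∀ k → k < n → f k ≡ false) → count f n ≡ 0
count-zero f zero z = refl
count-zero f (suc n) z rewrite z 0 z<s = count-zero (f ∘ suc) n (λ k k<n → z (suc k) (s<s k<n))

xor-interchange : ∀ a b c d → (a xor b) xor (c xor d) ≡ (a xor c) xor (b xor d)
xor-interchange a b c d = begin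
  (a xor b) xor (c xor d)   ≡⟨ xor-assoc a b _ ⟩
  a xor (b xor (c xor d))   ≡⟨ cong (a xor_) (xor-leftComm b c d) ⟩
  a xor (c xor (b xor d))   ≡⟨ xor-assoc a c _ ⟨
  (a xor c) xor (b xor d)   ∎
  where open ≡-Reasoning

xsum-xor : ∀ f g n → xsum (λ k → f k xor g k) n ≡ xsum f n xor xsum g n
xsum-xor f g zero = refl
xsum-xor f g (suc n) = trans (cong ((f 0 xor g 0) xor_) (xsum-xor (f ∘ suc) (g ∘ suc) n))
  (xor-interchange (f 0) (g 0) _ _)

-- Every off-diagonal entry cancels against its transpose; the induction peels off the first row
-- together with the first column.
handshake : ∀ (A : ℕ → ℕ → Bool) n → (∀ v → A v v ≡ false) → (∀ v w → A v w ≡ A w v) →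
            xsum (λ v → xsum (A v) n) n ≡ false
handshake A zero diag symm = refl
handshake A (suc n) diag symm = begin
  (A 0 0 xor row) xor xsum (λ v → A (suc v) 0 xor xsum (A (suc v) ∘ suc) n) n
    ≡⟨ cong₂ (λ x y → (x xor row) xor y) (diag 0) (xsum-xor (λ v → A (suc v) 0) _ n) ⟩
  row xor (xsum (λ v → A (suc v) 0) n xor xsum (λ v → xsum (A (suc v) ∘ suc) n) n)
    ≡⟨ cong₂ (λ x y → row xor (x xor y)) (xsum-cong n (λ v _ → symm (suc v) 0))
         (handshake (λ v w → A (suc v) (suc w)) n (λ v → diag (suc v)) (λ v w → symm (suc v) (suc w))) ⟩
  row xor (row xor false)   ≡⟨ xor-cancelˡ row false ⟩
  false ∎
  where
  open ≡-Reasoning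
  row : Bool
  row = xsum (A 0 ∘ suc) n

xsum-true : ∀ {f} n → (∀ k → k < n → f k ≡ true) → xsum f n ≡ odd n
xsum-true zero eq = refl
xsum-true (suc n) eq = cong₂ _xor_ (eq 0 z<s) (xsum-true n (λ k k<n → eq (suc k) (s<s k<n)))

count-not : ∀ f n → count f n + count (not ∘ f) n ≡ n
count-not f zero = refl
count-not f (suc n) = trans (interchange (bit (f 0)) _ (bit (not (f 0))) _)
  (cong₂ _+_ (bit-not (f 0)) (count-not (f ∘ suc) n))
  where
  interchange : ∀ a b c d → (a + b) + (c + d) ≡ (a + c) + (b + d)
  interchange = solve-∀
  bit-not : ∀ b → bit b + bit (not b) ≡ 1
  bit-not false = refl
  bit-not true = refl

-- Fully symmetric triangles of constant degree

-- B j k is the entry with barycentric coordinates (2 + 2K − j − k, j, k).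
module SymmetricTriangle (B : ℕ → ℕ → Bool) (K : ℕ)
  (rule : ∀ j k → j + k < 2 + (K + K) → B j (suc k) ≡ B j k xor B (suc j) k)
  (symˡ : ∀ i j k → i + j + k ≡ 2 + (K + K) → B j k ≡ B i k)
  (symʳ : ∀ i j k → i + j + k ≡ 2 + (K + K) → B j k ≡ B j i)
  (deg : ∀ u u′ → u + u′ ≡ 3 + (K + K) →
         count (λ w → B w u′) u + count (λ w → B w u) u′ ≡ 2 + K)
  (even : odd (2 + K) ≡ false)
  where

  row-palindromic : ∀ L k → L + k ≡ 3 + (K + K) → Palindromic (λ w → B w k) L
  row-palindromic L k L+k x y eq = symˡ y x k
    (suc-injective (trans (cong (_+ k) (trans (cong suc (+-comm y x)) eq)) L+k))

  -- Each entry of row `suc k` is the sum of two neighbours in row `k`, so partial row sums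
  -- telescope.
  row-half : ∀ t k → t + k ≤ 2 + (K + K) → xsum (λ w → B w (suc k)) t ≡ B 0 k xor B t k
  row-half t k t+k≤ = trans
    (xsum-cong t (λ w w<t → rule w k (<-≤-trans (+-monoˡ-< k w<t) t+k≤)))
    (xsum-telescope (λ w → B w k) t)

  -- On the side `k = 0` this is the centre of a palindromic row of odd length whose sum is an even
  -- degree. Elsewhere the rule makes it the sum of two mirror images.
  axis-zero : ∀ h k → h + h + k ≡ 2 + (K + K) → B h k ≡ false
  axis-zero h zero eq = begin
    B h 0                                         ≡⟨ odd-bit (B h 0) ⟨
    odd (bit (B h 0))                             ≡⟨ xor-identityʳ _ ⟨
    odd (bit (B h 0)) xor false                   ≡⟨ cong (odd (bit (B h 0)) xor_) (odd-double (count row h)) ⟨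
    odd (bit (B h 0)) xor odd (count row h + count row h)  ≡⟨ odd-+ (bit (B h 0)) _ ⟨
    odd (bit (B h 0) + (count row h + count row h))
      ≡⟨ cong odd (count-palindrome-odd row h (row-palindromic _ 0 len₀)) ⟨
    odd (count row (suc (h + h)))                 ≡⟨ cong odd (deg 0 (suc (h + h)) len) ⟩
    odd (2 + K)                                   ≡⟨ even ⟩
    false                                         ∎
    where
    open ≡-Reasoning
    row : ℕ → Bool
    row w = B w 0
    len : suc (h + h) ≡ 3 + (K + K)
    len = cong suc (trans (sym (+-identityʳ (h + h))) eq)
    len₀ : suc (h + h) + 0 ≡ 3 + (K + K)
    len₀ = cong suc eq
  axis-zero h (suc k) eq = begin
    B h (suc k)              ≡⟨ rule h k (subst (suc (h + k) ≤_) eq′ (+-monoˡ-≤ k (s≤s (m≤m+n h h)))) ⟩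
    B h k xor B (suc h) k    ≡⟨ cong (B h k xor_) (symˡ h (suc h) k (trans (cong (_+ k) (+-suc h h)) eq′)) ⟩
    B h k xor B h k          ≡⟨ xor-same (B h k) ⟩
    false                    ∎
    where
    open ≡-Reasoning
    eq′ : suc (h + h) + k ≡ 2 + (K + K)
    eq′ = trans (sym (+-suc (h + h) k)) eq

  -- Half the degree of the vertex 2 + 2k: the centres of its two palindromic rows vanish.
  left right : ℕ → ℕ → Bool
  left h w = B w (suc (h + h))
  right k w = B w (suc k + suc k)

  halves : ℕ → ℕ → ℕ
  halves h k = count (left h) (suc k) + count (right k) h

  halves-double : ∀ h k → h + k ≡ K → halves h k + halves h k ≡ 2 + K
  halves-double h k refl = begin
    halves h k + halves h k
      ≡⟨ interchange (count (left h) (suc k)) (count (right k) h) ⟩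
    (count (left h) (suc k) + count (left h) (suc k)) + (0 + (count (right k) h + count (right k) h))
      ≡⟨ cong₂ _+_ (count-palindrome-even (left h) (suc k) (row-palindromic _ _ len))
           (trans (count-palindrome-odd (right k) h (row-palindromic _ _ len′))
             (cong (λ b → bit b + (count (right k) h + count (right k) h)) (axis-zero h (suc k + suc k) axis))) ⟨
    count (left h) (suc k + suc k) + count (right k) (suc (h + h))
      ≡⟨ deg (suc k + suc k) (suc (h + h)) len ⟩
    2 + K ∎
    where
    open ≡-Reasoning
    interchange : ∀ x y → (x + y) + (x + y) ≡ (x + x) + (y + y)
    interchange = solve-∀
    len : suc k + suc k + suc (h + h) ≡ 3 + (K + K)
    len = lemma h k where
      lemma : ∀ h k → suc k + suc k + suc (h + h) ≡ 3 + (h + k + (h + k))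
      lemma = solve-∀
    len′ : suc (h + h) + (suc k + suc k) ≡ 3 + (K + K)
    len′ = trans (+-comm (suc (h + h)) _) len
    axis : h + h + (suc k + suc k) ≡ 2 + (K + K)
    axis = suc-injective len′

  -- Both half-row sums telescope to their end points. One end point lies on the axis, and a
  -- reflection moves another next to `B 0 (suc (k + k))`, which then cancels.
  odd-halves : ∀ h k → h + k ≡ K → odd (halves h k) ≡ B h (suc (k + k)) xor B 1 (suc (k + k))
  odd-halves h k refl = begin
    odd (halves h k)
      ≡⟨ odd-+ (count (left h) (suc k)) (count (right k) h) ⟩
    odd (count (left h) (suc k)) xor odd (count (right k) h)
      ≡⟨ cong₂ _xor_ (trans (odd-count (left h) (suc k)) (row-half (suc k) (h + h) le₁))
           (trans (odd-count (right k) h) (trans (cong (λ x → xsum (λ w → B w (suc x)) h) (+-suc k k))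
             (row-half h (suc (k + k)) le₂))) ⟩
    (B 0 (h + h) xor B (suc k) (h + h)) xor (B 0 (suc (k + k)) xor B h (suc (k + k)))
      ≡⟨ cong₂ (λ x y → (x xor y) xor (B 0 (suc (k + k)) xor B h (suc (k + k))))
           (trans (symʳ (2 + (k + k)) 0 (h + h) (sum₁ h k)) (rule 0 (suc (k + k)) le₃))
           (axis-zero (suc k) (h + h) (sum₂ h k)) ⟩
    ((B 0 (suc (k + k)) xor B 1 (suc (k + k))) xor false) xor (B 0 (suc (k + k)) xor B h (suc (k + k)))
      ≡⟨ cancel (B 0 (suc (k + k))) (B 1 (suc (k + k))) (B h (suc (k + k))) ⟩
    B h (suc (k + k)) xor B 1 (suc (k + k)) ∎
    where
    open ≡-Reasoning
    sum₁ : ∀ h k → 2 + (k + k) + 0 + (h + h) ≡ 2 + (h + k + (h + k))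
    sum₁ = solve-∀
    sum₂ : ∀ h k → suc k + suc k + (h + h) ≡ 2 + (h + k + (h + k))
    sum₂ = solve-∀
    sum₃ : ∀ h k → suc (h + h) + (suc (k + k)) ≡ 2 + (h + k + (h + k))
    sum₃ = solve-∀
    le₁ : suc k + (h + h) ≤ 2 + (K + K)
    le₁ = subst (suc k + (h + h) ≤_) (sum₂ h k) (+-monoˡ-≤ (h + h) (m≤m+n (suc k) (suc k)))
    le₂ : h + suc (k + k) ≤ 2 + (K + K)
    le₂ = subst (h + suc (k + k) ≤_) (sum₃ h k) (+-monoˡ-≤ (suc (k + k)) (≤-trans (m≤m+n h h) (n≤1+n _)))
    le₃ : suc (k + k) < 2 + (K + K)
    le₃ = subst (suc (k + k) <_) (sum₃ h k) (m<n+m (suc (k + k)) z<s)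
    cancel : ∀ a b c → ((a xor b) xor false) xor (a xor c) ≡ c xor b
    cancel false false c = sym (xor-identityʳ c)
    cancel false true false = refl
    cancel false true true = refl
    cancel true false false = refl
    cancel true false true = refl
    cancel true true false = refl
    cancel true true true = refl

  -- For `h = 0` the two entries in `odd-halves` are mirror images, with coordinates 0 and 1
  -- exchanged.
  halves-even : odd (halves 0 K) ≡ false
  halves-even = trans (odd-halves 0 K refl)
    (trans (cong (_xor B 1 (suc (K + K))) (symˡ 1 0 (suc (K + K)) refl)) (xor-same (B 1 (suc (K + K)))))

  -- Regularity makes all `halves h k` equal, hence even like `halves 0 K`; by `odd-halves` this is
  -- regularity modulo 4 in linear form.
  second-middle : ∀ h k → h + k ≡ K → B h (suc (k + k)) ≡ B 1 (suc (k + k))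
  second-middle h k eq = xor≡false _ _ (trans (sym (odd-halves h k eq)) (trans (cong odd same) halves-even))
    where
    same : halves h k ≡ halves 0 K
    same = double-injective {halves h k} {halves 0 K} (trans (halves-double h k eq) (sym (halves-double 0 K refl)))
    xor≡false : ∀ a b → a xor b ≡ false → a ≡ b
    xor≡false false false eq = refl
    xor≡false true true eq = refl

  -- `2 + K` is twice the even number `halves 0 K`, hence a multiple of 4.
  K-mod-4 : ∃ λ k → 2 + k * 4 ≡ K
  K-mod-4 with even⇒double (halves 0 K) halves-even
  ... | m , eq with trans (sym (cong₂ _+_ eq eq)) (halves-double 0 K refl)
  K-mod-4 | suc m , eq | eq′ = m , suc-injective (suc-injective (trans (four m) eq′))
    where
    four : ∀ m → 4 + m * 4 ≡ suc m + suc m + (suc m + suc m)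
    four = solve-∀

  -- For `j < K` the subtraction does not truncate and the first two coordinates are `2 + j` and
  -- `1 + j`: these are the entries next to the axis where the two agree.
  γ : ℕ → Bool
  γ j = B (suc j) ((K + K) ∸ suc (j + j))

  -- `m` is the difference of the first two coordinates. Difference 0 is the axis, difference 1 is
  -- `γ`, and the rule gives an entry from those at the two preceding differences, one of them
  -- shifted in `s`: the Fibonacci recurrence.
  fib-row : ∀ m s r → m + (s + s + r) ≡ K + K → ⟦ fib m ⟧ (λ j → γ (s + j)) ≡ B (suc s) r
  fib-row zero s r eq = sym (axis-zero (suc s) r (trans (cong (λ x → suc (x + r)) (+-suc s s)) (cong (2 +_) eq)))
  fib-row (suc zero) s r eq = trans (xor-identityʳ _) (cong₂ B (cong suc (+-identityʳ s))
    (trans (cong₂ (λ x y → x ∸ suc (y + y)) (sym eq) (+-identityʳ s)) (m+n∸m≡n (s + s) r)))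
  fib-row (suc (suc m)) s r eq = begin
    ⟦ fib (2 + m) ⟧ (λ j → γ (s + j))
      ≡⟨ ⟦fib⟧ m _ ⟩
    ⟦ fib (1 + m) ⟧ (λ j → γ (s + j)) xor ⟦ fib m ⟧ (λ j → γ (s + suc j))
      ≡⟨ cong₂ _xor_ (fib-row (suc m) s (suc r) (trans (shuffle₁ m s r) eq))
           (trans (⟦⟧-cong (fib m) (λ j → cong γ (+-suc s j))) (fib-row m (suc s) r (trans (shuffle₂ m s r) eq))) ⟩
    B (suc s) (suc r) xor B (2 + s) r
      ≡⟨ cong (_xor B (2 + s) r) (rule (suc s) r le) ⟩
    (B (suc s) r xor B (2 + s) r) xor B (2 + s) r
      ≡⟨ xor-assoc (B (suc s) r) _ _ ⟩
    B (suc s) r xor (B (2 + s) r xor B (2 + s) r)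
      ≡⟨ trans (cong (B (suc s) r xor_) (xor-same (B (2 + s) r))) (xor-identityʳ _) ⟩
    B (suc s) r ∎
    where
    open ≡-Reasoning
    shuffle₁ : ∀ m s r → suc m + (s + s + suc r) ≡ 2 + m + (s + s + r)
    shuffle₁ = solve-∀
    shuffle₂ : ∀ m s r → m + (suc s + suc s + r) ≡ 2 + m + (s + s + r)
    shuffle₂ = solve-∀
    le : suc s + r < 2 + (K + K)
    le = s<s (s≤s (subst (s + r ≤_) eq (≤-trans (+-monoˡ-≤ r (m≤m+n s s)) (m≤n+m _ (2 + m)))))

  γ-middle : ∀ p b → suc (p + b) ≡ K → γ p ≡ B 1 (suc (b + b))
  γ-middle p b eq = trans (cong (B (suc p)) index) (second-middle (suc p) b eq)
    where
    sum : ∀ p b → suc (p + b) + suc (p + b) ≡ suc (p + p) + suc (b + b)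
    sum = solve-∀
    index : K + K ∸ suc (p + p) ≡ suc (b + b)
    index = trans (cong (_∸ suc (p + p)) (trans (sym (cong₂ _+_ eq eq)) (sum p b))) (m+n∸m≡n (p + p) (suc (b + b)))

  γ-odd : ∀ p → p < K → γ p ≡ ⟦ fib (suc (p * 2)) ⟧ γ
  γ-odd p p<K = trans (γ-middle p b eq)
    (sym (fib-row (suc (p * 2)) 0 (suc (b + b)) (trans (sum p b) (cong₂ _+_ eq eq))))
    where
    b : ℕ
    b = K ∸ suc p
    eq : suc (p + b) ≡ K
    eq = m+[n∸m]≡n p<K
    sum : ∀ p b → suc (p * 2) + suc (b + b) ≡ suc (p + b) + suc (p + b)
    sum = solve-∀

  -- A reflection exchanges `suc (q + q)` and `2 + (j + j)` in the middle entry `B 1 (suc (q + q))`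
  -- and so places it at the even difference `q * 2`. This second reading gives the second family of
  -- equations.
  γ-even : ∀ q j → suc (q + j) ≡ K → γ j ≡ ⟦ fib (q * 2) ⟧ γ
  γ-even q j eq = begin
    γ j                   ≡⟨ γ-middle j q (trans (cong suc (+-comm j q)) eq) ⟩
    B 1 (suc (q + q))     ≡⟨ symʳ (2 + (j + j)) 1 (suc (q + q)) (trans (sum₁ q j) (cong (λ x → 2 + (x + x)) eq)) ⟩
    B 1 (2 + (j + j))     ≡⟨ fib-row (q * 2) 0 (2 + (j + j)) (trans (sum₂ q j) (cong (λ x → x + x) eq)) ⟨
    ⟦ fib (q * 2) ⟧ γ     ∎
    where
    open ≡-Reasoning
    sum₁ : ∀ q j → 2 + (j + j) + 1 + suc (q + q) ≡ 2 + (suc (q + j) + suc (q + j))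
    sum₁ = solve-∀
    sum₂ : ∀ q j → q * 2 + (2 + (j + j)) ≡ suc (q + j) + suc (q + j)
    sum₂ = solve-∀

  -- Zero `γ` kills the line `B 1`, which makes the side `B 0` constant; its middle is equivalent to
  -- an axis entry, so it vanishes. The rule then clears the triangle, and vertex 0 would have
  -- degree 0 instead of `2 + K`.
  γ-zero⇒⊥ : (∀ j → j < K → γ j ≡ false) → ⊥
  γ-zero⇒⊥ γ-zero = 0≢1+n (trans (sym (count-zero _ _
    (λ w w<3+2K → B-zero w 0 (subst (_≤ _) (sym (+-identityʳ w)) (≤-pred w<3+2K)))))
    (deg 0 (3 + (K + K)) refl))
    where
    half : ∀ {j m} → j * 2 < m → m ≤ K + K → j < K
    half {j} {m} lt le = *-cancelʳ-< 2 j K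
      (<-≤-trans lt (subst (m ≤_) (sym (trans (*-comm K 2) (cong (K +_) (+-identityʳ K)))) le))
    B-1-zero′ : ∀ r → r ≤ K + K → B 1 r ≡ false
    B-1-zero′ r r≤ = trans (sym (fib-row (K + K ∸ r) 0 r (m∸n+n≡m r≤)))
      (⟦fib⟧-zero (K + K ∸ r) γ (λ j lt → γ-zero j (half lt (m∸n≤m (K + K) r))))
    B-1-zero : ∀ r → r ≤ 1 + (K + K) → B 1 r ≡ false
    B-1-zero r r≤ with m≤n⇒m<n∨m≡n r≤
    ... | inj₁ r<1+2K = B-1-zero′ r (≤-pred r<1+2K)
    -- The end `r = 1 + (K + K)` is beyond `fib-row`, but its mirror image is `B 1 0`.
    ... | inj₂ refl = trans (symʳ 0 1 r refl) (B-1-zero′ 0 z≤n)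
    B-0-constant : ∀ k → k ≤ 2 + (K + K) → B 0 k ≡ B 0 0
    B-0-constant zero le = refl
    B-0-constant (suc k) le = trans (rule 0 k le)
      (trans (cong₂ _xor_ (B-0-constant k (<⇒≤ le)) (B-1-zero k (≤-pred le))) (xor-identityʳ _))
    centre : ∀ K → suc K + suc K ≡ 2 + (K + K)
    centre = solve-∀
    B-0-0 : B 0 0 ≡ false
    B-0-0 = begin
      B 0 0                ≡⟨ B-0-constant (suc K) (s≤s (m≤n⇒m≤1+n (m≤m+n K K))) ⟨
      B 0 (suc K)          ≡⟨ symˡ (suc K) 0 (suc K) (trans (cong (_+ suc K) (+-identityʳ (suc K))) (centre K)) ⟩
      B (suc K) (suc K)    ≡⟨ symʳ 0 (suc K) (suc K) (centre K) ⟩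
      B (suc K) 0          ≡⟨ axis-zero (suc K) 0 (trans (+-identityʳ _) (centre K)) ⟩
      false                ∎
      where open ≡-Reasoning
    B-zero : ∀ j k → j + k ≤ 2 + (K + K) → B j k ≡ false
    B-zero zero k le = trans (B-0-constant k le) B-0-0
    B-zero (suc j) k le = trans (xor-moveʳ _ (B j k) _ (rule j k le))
      (cong₂ _xor_ (B-zero j (suc k) (subst (_≤ 2 + (K + K)) (sym (+-suc j k)) le)) (B-zero j k (<⇒≤ le)))

-- Steinhaus triangles in barycentric coordinates

Array : Set
Array = ℕ → ℕ → ℕ → Bool

record Triangle (D : ℕ) (T : Array) : Set where
  constructor triangle
  field
    local : ∀ i j k → suc (i + j + k) ≡ D → T (suc i) j k xor (T i (suc j) k xor T i j (suc k)) ≡ false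

open Triangle

isZero : ℕ → Bool
isZero zero = true
isZero (suc _) = false

-- The indicator of a side obeys the local rule, so a constant 1 along a border can be absorbed into
-- a homogeneous relation.
Triangle-isZero : ∀ D → Triangle D (λ i j k → isZero i)
Triangle-isZero D = triangle λ i j k eq → xor-same (isZero i)

Triangle-xor : ∀ {D S T} → Triangle D S → Triangle D T → Triangle D (λ i j k → S i j k xor T i j k)
Triangle-xor {D} {S} {T} s t = triangle λ i j k eq → begin
  (S (suc i) j k xor T (suc i) j k) xor ((S i (suc j) k xor T i (suc j) k) xor (S i j (suc k) xor T i j (suc k)))
    ≡⟨ cong ((S (suc i) j k xor T (suc i) j k) xor_) (xor-interchange (S i (suc j) k) _ _ _) ⟩
  (S (suc i) j k xor T (suc i) j k) xor ((S i (suc j) k xor S i j (suc k)) xor (T i (suc j) k xor T i j (suc k)))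
    ≡⟨ xor-interchange (S (suc i) j k) _ _ _ ⟩
  (S (suc i) j k xor (S i (suc j) k xor S i j (suc k))) xor (T (suc i) j k xor (T i (suc j) k xor T i j (suc k)))
    ≡⟨ cong₂ _xor_ (local s i j k eq) (local t i j k eq) ⟩
  false ∎
  where open ≡-Reasoning

Triangle-swap₁₂ : ∀ {D T} → Triangle D T → Triangle D (λ i j k → T j i k)
Triangle-swap₁₂ {T = T} t = triangle λ i j k eq → trans (xor-leftComm (T j (suc i) k) (T (suc j) i k) _)
  (local t j i k (trans (cong (λ x → suc (x + k)) (+-comm j i)) eq))

Triangle-swap₂₃ : ∀ {D T} → Triangle D T → Triangle D (λ i j k → T i k j)
Triangle-swap₂₃ {T = T} t = triangle λ i j k eq → trans (cong (T (suc i) k j xor_) (xor-comm (T i k (suc j)) _))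
  (local t i k j (trans (shuffle i k j) eq))
  where
  shuffle : ∀ i k j → suc (i + k + j) ≡ suc (i + j + k)
  shuffle = solve-∀

Triangle-swap₁₃ : ∀ {D T} → Triangle D T → Triangle D (λ i j k → T k j i)
Triangle-swap₁₃ t = Triangle-swap₁₂ (Triangle-swap₂₃ (Triangle-swap₁₂ t))

-- The local rule determines layer `suc j` from layer `j`, so one side determines the triangle.
Triangle-vanish : ∀ {D T} → Triangle D T → (∀ i k → i + k ≡ D → T i 0 k ≡ false) →
                  ∀ j i k → i + j + k ≡ D → T i j k ≡ false
Triangle-vanish t edge zero i k eq = edge i k (trans (cong (_+ k) (sym (+-identityʳ i))) eq)
Triangle-vanish {T = T} t edge (suc j) i k eq =
  middle (T (suc i) j k) (T i (suc j) k) (T i j (suc k)) (local t i j k eq′)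
  (Triangle-vanish t edge j (suc i) k eq′)
  (Triangle-vanish t edge j i (suc k) (trans (+-suc (i + j) k) eq′))
  where
  eq′ : suc (i + j + k) ≡ _
  eq′ = trans (cong (_+ k) (sym (+-suc i j))) eq
  middle : ∀ a b c → a xor (b xor c) ≡ false → a ≡ false → c ≡ false → b ≡ false
  middle false b false eq refl refl = trans (sym (xor-identityʳ b)) eq

-- Steinhaus graphs of odd degree

module OddRegular (A : ℕ → ℕ → Bool) (E d : ℕ)
  (diag : ∀ v → A v v ≡ false)
  (symm : ∀ v w → A v w ≡ A w v)
  (rule : ∀ v w → v < w → w ≤ suc E → A (suc v) (suc w) ≡ A v w xor A v (suc w))
  (regular : ∀ v → v < 3 + E → count (A v) (3 + E) ≡ d)
  (odd-d : odd d ≡ true)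
  where

  D : ℕ
  D = suc E

  odd-degree : ∀ v → v < 2 + D → xsum (A v) (2 + D) ≡ true
  odd-degree v v<n = trans (sym (odd-count (A v) (2 + D))) (trans (cong odd (regular v v<n)) odd-d)

  -- Handshaking: the number `2 + D` of vertices of odd degree is even.
  D-even : odd D ≡ false
  D-even = trans (sym (not-involutive (odd D)))
    (trans (sym (xsum-true (2 + D) odd-degree)) (handshake A (2 + D) diag symm))

  -- The degree of the vertex suc u is odd, and both parts of its row telescope modulo 2.
  border-parity : ∀ u p → u + suc p ≡ D → A u (2 + u) xor (A 0 (2 + u) xor A u (suc D)) ≡ true
  border-parity u p eq = begin
    A u (2 + u) xor (A 0 (2 + u) xor A u (suc D))
      ≡⟨ rearrange (A u (2 + u)) (A 0 (2 + u)) (A u (suc D)) (A u (suc u)) ⟩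
    (A 0 (2 + u) xor (A u (suc u) xor A u (2 + u))) xor (false xor (A u (suc u) xor A u (suc D)))
      ≡⟨ cong₂ _xor_ (sym left) (cong₂ _xor_
           (sym (trans (cong (A (suc u)) (+-identityʳ (suc u))) (diag (suc u)))) (sym right)) ⟩
    xsum (A (suc u)) (suc u) xor xsum (λ j → A (suc u) (suc u + j)) (suc (suc p))
      ≡⟨ cong₂ _xor_ (odd-count (A (suc u)) (suc u)) (odd-count (λ j → A (suc u) (suc u + j)) (suc (suc p))) ⟨
    odd (count (A (suc u)) (suc u)) xor odd (count (λ j → A (suc u) (suc u + j)) (suc (suc p)))
      ≡⟨ odd-+ (count (A (suc u)) (suc u)) _ ⟨
    odd (count (A (suc u)) (suc u) + count (λ j → A (suc u) (suc u + j)) (suc (suc p)))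
      ≡⟨ cong odd (trans (cong (count (A (suc u))) (sym split)) (count-+ (A (suc u)) (suc u) (suc (suc p)))) ⟨
    odd (count (A (suc u)) (2 + D))
      ≡⟨ trans (cong odd (regular (suc u) (s<s (m<n⇒m<1+n u<D)))) odd-d ⟩
    true ∎
    where
    open ≡-Reasoning
    u<D : u < D
    u<D = subst (u <_) eq (m<m+n u z<s)
    split : suc u + suc (suc p) ≡ 2 + D
    split = trans (cong suc (+-suc u (suc p))) (cong (2 +_) eq)
    left : xsum (A (suc u)) (suc u) ≡ A 0 (2 + u) xor (A u (suc u) xor A u (2 + u))
    left = trans (xsum-cong (suc u) (λ k k<1+u → trans (symm (suc u) k)
        (trans (xor-moveʳ (A (suc k) (2 + u)) (A k (2 + u)) (A k (suc u))
            (trans (rule k (suc u) k<1+u u<D) (xor-comm (A k (suc u)) (A k (2 + u)))))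
          (xor-comm (A (suc k) (2 + u)) (A k (2 + u))))))
      (trans (xsum-telescope (λ k → A k (2 + u)) (suc u)) (cong (A 0 (2 + u) xor_) (rule u (suc u) (n<1+n u) u<D)))
    right : xsum (λ j → A (suc u) (suc u + suc j)) (suc p) ≡ A u (suc u) xor A u (suc D)
    right = trans (xsum-cong (suc p) (λ j j<1+p → trans (rule u (u + suc j) (m<m+n u z<s)
        (subst (u + suc j ≤_) eq (+-monoʳ-≤ u j<1+p)))
        (cong (λ x → A u (u + suc j) xor A u x) (sym (+-suc u (suc j))))))
      (trans (xsum-telescope (λ j → A u (u + suc j)) (suc p))
        (cong₂ (λ x y → A u x xor A u y) (+-comm u 1) (trans (+-suc u (suc p)) (cong suc eq))))
    rearrange : ∀ a b c e → a xor (b xor c) ≡ (b xor (e xor a)) xor (false xor (e xor c))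
    rearrange a b c e = begin
      a xor (b xor c)                       ≡⟨ xor-leftComm a b c ⟩
      b xor (a xor c)                       ≡⟨ cong (b xor_) (xor-cancelˡ e (a xor c)) ⟨
      b xor (e xor (e xor (a xor c)))       ≡⟨ cong (λ x → b xor (e xor x)) (xor-leftComm e a c) ⟩
      b xor (e xor (a xor (e xor c)))       ≡⟨ cong (b xor_) (xor-assoc e a _) ⟨
      b xor ((e xor a) xor (e xor c))       ≡⟨ xor-assoc b _ _ ⟨
      (b xor (e xor a)) xor (e xor c)       ∎

  last-entry : A 0 (suc D) ≡ true
  last-entry = trans (sym (xor-cancelˡ (A 0 2) _)) (border-parity 0 E refl)

  -- For the edge position `T i j k`, `k` vertices come before both ends, `j` between them and `i`
  -- after them. `U` omits the side `j = 0`.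
  T U : Array
  T i j k = A k (suc (k + j))
  U i j k = T i (suc j) k

  T-triangle : Triangle D T
  T-triangle = triangle λ i j k eq → let a = A k (suc (k + j)); b = A k (suc (suc (k + j))) in begin
    A k (suc (k + j)) xor (A k (suc (k + suc j)) xor A (suc k) (suc (suc k + j)))
      ≡⟨ cong₂ (λ x y → A k (suc (k + j)) xor (A k (suc x) xor y)) (+-suc k j)
           (rule k (suc (k + j)) (s≤s (m≤m+n k j))
             (subst (suc (k + j) ≤_) eq (s≤s (subst (k + j ≤_) (shuffle k j i) (m≤m+n (k + j) i))))) ⟩
    a xor (b xor (a xor b))   ≡⟨ cong (a xor_) (xor-leftComm b a b) ⟩
    a xor (a xor (b xor b))   ≡⟨ xor-cancelˡ a _ ⟩
    b xor b                   ≡⟨ xor-same b ⟩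
    false ∎
    where
    open ≡-Reasoning
    shuffle : ∀ k j i → k + j + i ≡ i + j + k
    shuffle = solve-∀

  U-triangle : Triangle E U
  U-triangle = triangle λ i j k eq → local T-triangle i (suc j) k
    (trans (cong (λ x → suc (x + k)) (+-suc i j)) (cong suc eq))

  -- On the side `j = 0` this is `border-parity`. All summands are triangles after permuting
  -- coordinates, so the relation spreads from that side.
  U-relation : ∀ j i k → i + j + k ≡ E → U i j k xor (U i k j xor (U j i k xor isZero j)) ≡ false
  U-relation = Triangle-vanish
    (Triangle-xor U-triangle (Triangle-xor (Triangle-swap₂₃ U-triangle)
      (Triangle-xor (Triangle-swap₁₂ U-triangle) (Triangle-swap₁₂ (Triangle-isZero E)))))
    edge
    where
    flip : ∀ a b c → a xor (b xor c) ≡ true → a xor (b xor (c xor true)) ≡ false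
    flip false false true eq = refl
    flip false true false eq = refl
    flip true false false eq = refl
    flip true true true eq = refl
    edge : ∀ i k → i + k ≡ E → U i 0 k xor (U i k 0 xor (U 0 i k xor true)) ≡ false
    edge i k eq = flip (U i 0 k) (U i k 0) (U 0 i k)
      (trans (cong₂ (λ x y → A k (suc x) xor (A 0 (2 + k) xor A k (suc y))) (+-comm k 1) sum) (border-parity k i sum))
      where
      sum : k + suc i ≡ D
      sum = trans (+-suc k i) (cong suc (trans (+-comm k i) eq))

  U-mirror : ∀ i k → i + k ≡ E → U i 0 k xor (U k 0 i xor (isZero i xor isZero k)) ≡ false
  U-mirror i k eq = combine (U 0 i k) (U 0 k i) (U i 0 k) (U k 0 i) (isZero i) (isZero k)
    -- Both instances have first coordinate 0 and share `U 0 i k` and `U 0 k i`, which cancel in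
    -- their sum.
    (U-relation i 0 k eq) (U-relation k 0 i (trans (+-comm k i) eq))
    where
    combine : ∀ a b c d x y → a xor (b xor (c xor x)) ≡ false → b xor (a xor (d xor y)) ≡ false →
              c xor (d xor (x xor y)) ≡ false
    combine a b c d x y eq₁ eq₂ = begin
      c xor (d xor (x xor y))                                   ≡⟨ cong (c xor_) (xor-leftComm d x y) ⟩
      c xor (x xor (d xor y))                                   ≡⟨ xor-assoc c x _ ⟨
      (c xor x) xor (d xor y)
        ≡⟨ cong₂ _xor_ (xor-solve a b (c xor x) eq₁) (xor-solve b a (d xor y) eq₂) ⟩
      (a xor b) xor (b xor a)                                   ≡⟨ cong ((a xor b) xor_) (xor-comm b a) ⟩
      (a xor b) xor (a xor b)                                   ≡⟨ xor-same (a xor b) ⟩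
      false ∎
      where
      open ≡-Reasoning
      xor-solve : ∀ a b c → a xor (b xor c) ≡ false → c ≡ a xor b
      xor-solve false false c eq = eq
      xor-solve false true true eq = refl
      xor-solve true false true eq = refl
      xor-solve true true c eq = trans (sym (not-involutive c)) eq

  -- The layer `j = 1` of `H` vanishes by `U-mirror`, so `H` is constant on the side `j = 0`. As `D`
  -- is even, that side has a centre, where the reflected terms coincide and `H` is 0.
  T-mirror : ∀ j i k → i + j + k ≡ D → T i j k xor (T k j i xor (isZero i xor isZero k)) ≡ false
  T-mirror = Triangle-vanish H-triangle edge
    where
    H : Array
    H i j k = T i j k xor (T k j i xor (isZero i xor isZero k))
    H-triangle : Triangle D H
    H-triangle = Triangle-xor T-triangle (Triangle-xor (Triangle-swap₁₃ T-triangle)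
      (Triangle-xor (Triangle-isZero D) (Triangle-swap₁₃ (Triangle-isZero D))))
    outer≡ : ∀ a b c → b ≡ false → a xor (b xor c) ≡ false → a ≡ c
    outer≡ false false false refl eq = refl
    outer≡ true false true refl eq = refl
    constant : ∀ k i → i + k ≡ D → H i 0 k ≡ H (i + k) 0 0
    constant zero i eq = cong (λ x → H x 0 0) (sym (+-identityʳ i))
    constant (suc k) i eq = trans
      (sym (outer≡ (H (suc i) 0 k) (H i 1 k) (H i 0 (suc k)) (U-mirror i k (suc-injective eq′))
        (local H-triangle i 0 k (trans (cong (λ x → suc (x + k)) (+-identityʳ i)) eq′))))
      (trans (constant k (suc i) eq′) (cong (λ x → H x 0 0) (sym (+-suc i k))))
      where
      eq′ : suc i + k ≡ D
      eq′ = trans (sym (+-suc i k)) eq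
    centre : H D 0 0 ≡ false
    centre with even⇒double D D-even
    ... | c , D≡c+c = trans (trans (cong (λ x → H x 0 0) D≡c+c) (sym (constant c c (sym D≡c+c))))
      (trans (xor-cancelˡ (T c 0 c) _) (xor-same (isZero c)))
    edge : ∀ i k → i + k ≡ D → H i 0 k ≡ false
    edge i k eq = trans (constant k i eq) (trans (cong (λ x → H x 0 0) eq) centre)

  mirror : ∀ i j k → suc i + j + suc k ≡ D → A (suc k) (suc (suc k + j)) ≡ A (suc i) (suc (suc i + j))
  mirror i j k eq = xor-zero (T-mirror j (suc i) (suc k) eq)
    where
    xor-zero : ∀ {a b} → a xor (b xor false) ≡ false → a ≡ b
    xor-zero {false} {false} eq = refl
    xor-zero {true} {true} eq = refl

  -- Here exactly one outer coordinate is zero, so the correction term in `T-mirror` is 1.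
  last-column : ∀ j k → suc (j + k) ≡ D → A (suc k) (suc D) ≡ not (A 0 (suc j))
  last-column j k eq = trans (cong (λ x → A (suc k) (suc x)) (trans (sym eq) (cong suc (+-comm j k))))
    (flip _ _ (T-mirror j 0 (suc k) (trans (+-suc j k) eq)))
    where
    flip : ∀ a b → a xor (b xor true) ≡ false → a ≡ not b
    flip false true eq = refl
    flip true false eq = refl

  inner : ℕ → ℕ → Bool
  inner v w = A (suc v) (suc w)

  inner-mirror-upper : ∀ v j v′ w′ → suc (v + v′) ≡ D → suc (suc (v + j) + w′) ≡ D →
                       inner v (suc (v + j)) ≡ inner v′ w′
  inner-mirror-upper v j v′ w′ eqᵥ eq_w = begin
    inner v (suc (v + j))      ≡⟨ mirror w′ j v (trans (shuffle w′ j v) eq_w) ⟩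
    inner w′ (suc (w′ + j))    ≡⟨ cong (inner w′) complement ⟨
    inner w′ v′                ≡⟨ symm (suc w′) (suc v′) ⟩
    inner v′ w′                ∎
    where
    open ≡-Reasoning
    shuffle : ∀ w′ j v → suc w′ + j + suc v ≡ suc (suc (v + j) + w′)
    shuffle = solve-∀
    shuffle′ : ∀ v j w′ → suc (suc (v + j) + w′) ≡ suc (v + suc (w′ + j))
    shuffle′ = solve-∀
    complement : v′ ≡ suc (w′ + j)
    complement = +-cancelˡ-≡ v v′ (suc (w′ + j)) (suc-injective (trans eqᵥ (trans (sym eq_w) (shuffle′ v j w′))))

  inner-mirror : ∀ v w v′ w′ → suc (v + v′) ≡ D → suc (w + w′) ≡ D → inner v w ≡ inner v′ w′
  inner-mirror v w v′ w′ eqᵥ eq_w with compare v w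
  ... | less v j = inner-mirror-upper v j v′ w′ eqᵥ eq_w
  ... | greater w j = trans (symm _ _) (trans (inner-mirror-upper w j w′ v′ eq_w eqᵥ) (symm _ _))
  ... | equal v with +-cancelˡ-≡ v w′ v′ (suc-injective (trans eq_w (sym eqᵥ)))
  ... | refl = trans (diag (suc v)) (sym (diag (suc v′)))

  inner-degree : ℕ → ℕ
  inner-degree v = count (inner v) D

  degree-split : ∀ v v′ → suc (v + v′) ≡ D →
                 bit (A 0 (suc v)) + (inner-degree v + bit (not (A 0 (suc v′)))) ≡ d
  degree-split v v′ eq = begin
    bit (A 0 (suc v)) + (inner-degree v + bit (not (A 0 (suc v′))))
      ≡⟨ cong₂ (λ x y → bit x + (inner-degree v + bit y)) (symm (suc v) 0)
           (last-column v′ v (trans (cong suc (+-comm v′ v)) eq)) ⟨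
    bit (A (suc v) 0) + (inner-degree v + bit (inner v D))
      ≡⟨ cong (bit (A (suc v) 0) +_) (count-last (inner v) D) ⟨
    count (A (suc v)) (2 + D)
      ≡⟨ regular (suc v) (s<s (m<n⇒m<1+n (subst (v <_) eq (s≤s (m≤m+n v v′))))) ⟩
    d ∎
    where open ≡-Reasoning

  -- Mirror images have the same inner degree, so comparing their degrees as integers cancels it.
  first-row-palindromic : ∀ v v′ → suc (v + v′) ≡ D → A 0 (suc v) ≡ A 0 (suc v′)
  first-row-palindromic v v′ eq = bits (A 0 (suc v)) (A 0 (suc v′)) (inner-degree v)
    (trans (degree-split v v′ eq) (trans (sym (degree-split v′ v eq′))
      (cong (λ x → bit (A 0 (suc v′)) + (x + bit (not (A 0 (suc v)))))
        (sym (count-reverse D (λ w w′ → inner-mirror v w v′ w′ eq))))))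
    where
    eq′ : suc (v′ + v) ≡ D
    eq′ = trans (cong suc (+-comm v′ v)) eq
    bits : ∀ a b x → bit a + (x + bit (not b)) ≡ bit b + (x + bit (not a)) → a ≡ b
    bits false false x eq = refl
    bits true true x eq = refl
    bits false true x eq = ⊥-elim (m≢1+m+n x (trans (sym (+-identityʳ x)) eq))
    bits true false x eq = ⊥-elim (m≢1+m+n x (trans (sym (+-identityʳ x)) (sym eq)))

  -- Since the first row is a palindrome, each inner vertex is joined to exactly one of the first
  -- and last vertices.
  suc-inner-degree : ∀ v v′ → suc (v + v′) ≡ D → suc (inner-degree v) ≡ d
  suc-inner-degree v v′ eq = trans (bits (A 0 (suc v)) (inner-degree v))
    (trans (cong (λ b → bit (A 0 (suc v)) + (inner-degree v + bit (not b))) (first-row-palindromic v v′ eq))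
      (degree-split v v′ eq))
    where
    bits : ∀ b x → suc x ≡ bit b + (x + bit (not b))
    bits false x = +-comm 1 x
    bits true x = cong suc (sym (+-identityʳ x))

  -- The first and last vertices are joined to each other, and on the inner vertices their rows are
  -- complementary up to reversal.
  double-degree : d + d ≡ 2 + D
  double-degree = begin
    d + d
      ≡⟨ cong₂ _+_ (regular 0 z<s) (regular (suc D) (n<1+n (suc D))) ⟨
    count (A 0) (2 + D) + count (A (suc D)) (2 + D)
      ≡⟨ cong₂ _+_ first last ⟩
    suc (count row D) + suc (count (not ∘ row) D)
      ≡⟨ cong suc (+-suc (count row D) _) ⟩
    2 + (count row D + count (not ∘ row) D)
      ≡⟨ cong (2 +_) (count-not row D) ⟩
    2 + D ∎
    where
    open ≡-Reasoning
    row : ℕ → Bool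
    row v = A 0 (suc v)
    first : count (A 0) (2 + D) ≡ suc (count row D)
    first = begin
      bit (A 0 0) + count row (suc D)     ≡⟨ cong₂ (λ x y → bit x + y) (diag 0) (count-last row D) ⟩
      count row D + bit (A 0 (suc D))     ≡⟨ cong (λ x → count row D + bit x) last-entry ⟩
      count row D + 1                     ≡⟨ +-comm (count row D) 1 ⟩
      suc (count row D)                   ∎
    last : count (A (suc D)) (2 + D) ≡ suc (count (not ∘ row) D)
    last = begin
      bit (A (suc D) 0) + count (inner D) (suc D)
        ≡⟨ cong₂ (λ x y → bit x + y) (trans (symm (suc D) 0) last-entry) (count-last (inner D) D) ⟩
      suc (count (inner D) D + bit (inner D D))
        ≡⟨ cong₂ (λ x y → suc (x + bit y))
             (count-reverse D (λ k l eq → trans (symm (suc D) (suc k))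
               (last-column l k (trans (cong suc (+-comm l k)) eq))))
             (diag (suc D)) ⟩
      suc (count (not ∘ row) D + 0)
        ≡⟨ cong suc (+-identityʳ _) ⟩
      suc (count (not ∘ row) D) ∎

  half-degree : ∃ λ c → D ≡ c + c × d ≡ suc c × odd c ≡ false
  half-degree with even⇒double D D-even
  ... | c , D≡ = c , D≡ , d≡ , trans (sym (not-involutive (odd c))) (cong not (trans (sym (cong odd d≡)) odd-d))
    where
    d≡ : d ≡ suc c
    d≡ = double-injective (trans double-degree (trans (cong (2 +_) D≡) (cong suc (sym (+-suc c c)))))

  -- The inner triangle and its full symmetry

  module Core (K : ℕ) (D≡ : D ≡ 4 + (K + K)) (d≡ : d ≡ 3 + K) (even : odd (2 + K) ≡ false) where

    B : ℕ → ℕ → Bool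
    B j k = inner k (suc (k + j))

    B-rule : ∀ j k → j + k < 2 + (K + K) → B j (suc k) ≡ B j k xor B (suc j) k
    B-rule j k lt = trans (rule (suc k) (suc (suc k + j)) (s≤s (s≤s (m≤m+n k j))) le)
      (cong (λ x → B j k xor inner k (suc x)) (sym (+-suc k j)))
      where
      le : suc (suc k + j) ≤ D
      le = subst (suc (suc k + j) ≤_) (sym D≡) (s≤s (s≤s (subst (_≤ 2 + (K + K)) (+-comm j k) (<⇒≤ lt))))

    B-symʳ : ∀ i j k → i + j + k ≡ 2 + (K + K) → B j k ≡ B j i
    B-symʳ i j k eq = mirror i j k (trans (cong suc (+-suc (i + j) k)) (trans (cong (2 +_) eq) (sym D≡)))

    -- On the side `k = 0` entries are sums of neighbours in the palindromic first row; `B-rule`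
    -- carries the symmetry inward.
    B-symˡ : ∀ i j k → i + j + k ≡ 2 + (K + K) → B j k ≡ B i k
    B-symˡ i j zero eq = begin
      A 1 (2 + j)
        ≡⟨ rule 0 (suc j) z<s (bound j i eq) ⟩
      A 0 (1 + j) xor A 0 (2 + j)
        ≡⟨ cong₂ _xor_ (first-row-palindromic j (suc i) (trans (cong suc (+-suc j i)) (sum j i eq′)))
             (first-row-palindromic (suc j) i (sum j i eq′)) ⟩
      A 0 (2 + i) xor A 0 (1 + i)
        ≡⟨ xor-comm (A 0 (2 + i)) _ ⟩
      A 0 (1 + i) xor A 0 (2 + i)
        ≡⟨ rule 0 (suc i) z<s (bound i j eq′) ⟨
      A 1 (2 + i) ∎
      where
      open ≡-Reasoning
      eq′ : j + i + 0 ≡ 2 + (K + K)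
      eq′ = trans (cong (_+ 0) (+-comm j i)) eq
      sum : ∀ j i → j + i + 0 ≡ 2 + (K + K) → suc (suc j + i) ≡ D
      sum j i eq = trans (cong (2 +_) (trans (sym (+-identityʳ (j + i))) eq)) (sym D≡)
      bound : ∀ j i → i + j + 0 ≡ 2 + (K + K) → suc j ≤ D
      bound j i eq = subst (suc j ≤_) (sum i j eq) (s≤s (m≤n+m j (suc i)))
    B-symˡ i j (suc k) eq = begin
      B j (suc k)               ≡⟨ B-rule j k (bound i j eq) ⟩
      B j k xor B (suc j) k
        ≡⟨ cong₂ _xor_ (B-symˡ (suc i) j k eq₁)
             (B-symˡ i (suc j) k (trans (cong (_+ k) (+-suc i j)) eq₁)) ⟩
      B (suc i) k xor B i k     ≡⟨ xor-comm (B (suc i) k) _ ⟩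
      B i k xor B (suc i) k     ≡⟨ B-rule i k (bound j i (trans (cong (_+ suc k) (+-comm j i)) eq)) ⟨
      B i (suc k)               ∎
      where
      open ≡-Reasoning
      eq₁ : suc i + j + k ≡ 2 + (K + K)
      eq₁ = trans (sym (+-suc (i + j) k)) eq
      bound : ∀ i j → i + j + suc k ≡ 2 + (K + K) → j + k < 2 + (K + K)
      bound i j eq = subst (j + k <_) (trans (sym (+-suc (i + j) k)) eq) (s≤s (+-monoˡ-≤ k (m≤n+m j i)))

    B-degree : ∀ u u′ → u + u′ ≡ 3 + (K + K) → count (λ w → B w u′) u + count (λ w → B w u) u′ ≡ 2 + K
    B-degree u u′ eq = begin
      count (λ w → B w u′) u + count (λ w → B w u) u′
        ≡⟨ cong₂ _+_ (count-cong u left) (count-cong u′ (λ w _ → cong (inner u) (sym (+-suc u w)))) ⟩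
      count (inner u) u + count (λ w → inner u (u + suc w)) u′
        ≡⟨ cong (λ b → count (inner u) u + (bit b + count (λ w → inner u (u + suc w)) u′))
             (trans (cong (inner u) (+-identityʳ u)) (diag (suc u))) ⟨
      count (inner u) u + count (λ w → inner u (u + w)) (suc u′)
        ≡⟨ count-+ (inner u) u (suc u′) ⟨
      count (inner u) (u + suc u′)
        ≡⟨ cong (count (inner u)) (trans (+-suc u u′) sum) ⟩
      inner-degree u
        ≡⟨ suc-injective (trans (suc-inner-degree u u′ sum) d≡) ⟩
      2 + K ∎
      where
      open ≡-Reasoning
      sum : suc (u + u′) ≡ D
      sum = trans (cong suc eq) (sym D≡)
      -- An entry left of the diagonal has coordinates `u′`, `j`, `w`; two transpositions bring it
      -- into row `u′`.
      left : ∀ w → w < u → B w u′ ≡ inner u w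
      left w w<u with m≤n⇒∃[o]m+o≡n w<u
      ... | j , refl = begin
        B w u′                    ≡⟨ B-symˡ j w u′ (suc-injective (trans (cong (λ x → suc (x + u′)) (+-comm j w)) eq)) ⟩
        B j u′                    ≡⟨ B-symʳ w j u′ (suc-injective eq) ⟩
        B j w                     ≡⟨ symm (suc w) (suc (suc (w + j))) ⟩
        inner (suc (w + j)) w     ∎

    open SymmetricTriangle B K B-rule B-symˡ B-symʳ B-degree even public using (γ; γ-odd; γ-even; K-mod-4; γ-zero⇒⊥)

-- From matrices on Fin n to functions on ℕ

module _ {n : ℕ} (M : Matrix n) where

  -- The default `false` keeps the zero diagonal and the symmetry valid for all indices.
  entry : ℕ → ℕ → Bool
  entry v w with v <? n | w <? n
  ... | yes v<n | yes w<n = M (fromℕ< v<n) (fromℕ< w<n)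
  ... | _ | _ = false

  entry-fromℕ< : ∀ {v w} (v<n : v < n) (w<n : w < n) → entry v w ≡ M (fromℕ< v<n) (fromℕ< w<n)
  entry-fromℕ< {v} {w} v<n w<n with v <? n | w <? n
  ... | yes _ | yes _ = refl
  ... | yes _ | no w≮n = contradiction w<n w≮n
  ... | no v≮n | _ = contradiction v<n v≮n

  entry-toℕ : ∀ i j → entry (toℕ i) (toℕ j) ≡ M i j
  entry-toℕ i j = trans (entry-fromℕ< (toℕ<n i) (toℕ<n j)) (cong₂ M (fromℕ<-toℕ i _) (fromℕ<-toℕ j _))

  sum-count : ∀ {m} (f : Fin m → Bool) h → (∀ j → f j ≡ h (toℕ j)) → listSum (tabulate (bit ∘ f)) ≡ count h m
  sum-count {zero} f h eq = refl
  sum-count {suc m} f h eq = cong₂ _+_ (cong bit (eq Fin.zero)) (sum-count (f ∘ Fin.suc) (h ∘ suc) (eq ∘ Fin.suc))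

  degree-count : ∀ i → degree M i ≡ count (entry (toℕ i)) n
  degree-count i = trans (cong listSum (map-tabulate id (bit ∘ M i)))
    (sum-count (M i) (entry (toℕ i)) (λ j → sym (entry-toℕ i j)))

  module _ (steinhaus : IsSteinhaus M) where
    open IsSteinhaus steinhaus

    entry-diag : ∀ v → entry v v ≡ false
    entry-diag v with v <? n
    ... | yes v<n = diag (fromℕ< v<n)
    ... | no _ = refl

    entry-symm : ∀ v w → entry v w ≡ entry w v
    entry-symm v w with v <? n | w <? n
    ... | yes v<n | yes w<n = symm (fromℕ< v<n) (fromℕ< w<n)
    ... | yes _ | no _ = refl
    ... | no _ | yes _ = refl
    ... | no _ | no _ = refl

    entry-rule : ∀ v w → v < w → suc w < n → entry (suc v) (suc w) ≡ entry v w xor entry v (suc w)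
    entry-rule v w v<w 1+w<n = begin
      entry (suc v) (suc w)
        ≡⟨ entry-fromℕ< 1+v<n 1+w<n ⟩
      M (fromℕ< 1+v<n) (fromℕ< 1+w<n)
        ≡⟨ rule _ _ (fromℕ< v<n) (fromℕ< w<n)
             (trans (toℕ-fromℕ< 1+v<n) (cong suc (sym (toℕ-fromℕ< v<n))))
             (trans (toℕ-fromℕ< 1+w<n) (cong suc (sym (toℕ-fromℕ< w<n))))
             (subst₂ _<_ (sym (toℕ-fromℕ< 1+v<n)) (sym (toℕ-fromℕ< 1+w<n)) (s<s v<w)) ⟩
      M (fromℕ< v<n) (fromℕ< w<n) xor M (fromℕ< v<n) (fromℕ< 1+w<n)
        ≡⟨ cong₂ _xor_ (entry-fromℕ< v<n w<n) (entry-fromℕ< v<n 1+w<n) ⟨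
      entry v w xor entry v (suc w) ∎
      where
      open ≡-Reasoning
      w<n : w < n
      w<n = <-trans (n<1+n w) 1+w<n
      v<n : v < n
      v<n = <-trans v<w w<n
      1+v<n : suc v < n
      1+v<n = <-trans (s<s v<w) 1+w<n

entry-regular : ∀ {n} {M : Matrix n} {d} → IsRegular M d → ∀ v → v < n → count (entry M v) n ≡ d
entry-regular {n} {M} reg v v<n = trans (cong (λ x → count (entry M x) n) (sym (toℕ-fromℕ< v<n)))
  (trans (sym (degree-count M (fromℕ< v<n))) (reg (fromℕ< v<n)))

-- The finite computation and the conclusion

odd-%2 : ∀ d → d % 2 ≡ 1 → odd d ≡ true
odd-%2 (suc zero) eq = refl
odd-%2 (suc (suc d)) eq = trans (not-involutive (odd d)) (odd-%2 d eq)

-- The 187 rounds cover `L = 2, 6, …, 746`. Each uses four odd forms, 748 in all, so lists of length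
-- 750 suffice.
checked : run 187 0 (evens 750 (fib 0) (fib 1)) (evens 750 (fib 1) (fib 2)) [] ≡ true
checked = refl

-- The number of vertices is `10 + k * 8`, which is at least 1506 once `k` reaches 187.
block<187 : ∀ k K E → 2 + k * 4 ≡ K → suc E ≡ 4 + (K + K) → 3 + E ≤ 1500 → k < 187
block<187 k K E refl eq n≤1500 = ≰⇒> λ 187≤k → <⇒≱ (<ᵇ⇒< 1500 1506 tt)
  (≤-trans (+-monoʳ-≤ 10 (*-monoˡ-≤ 8 187≤k)) (subst (_≤ 1500) (trans (cong (2 +_) eq) (shuffle k)) n≤1500))
  where
  shuffle : ∀ k → 6 + ((2 + k * 4) + (2 + k * 4)) ≡ 10 + k * 8
  shuffle = solve-∀

theorem9 : ∀ (n : ℕ) → 2 < n → n ≤ 1500 →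
    ¬ (Σ (Matrix n) λ M → Σ ℕ λ d →
    IsSteinhaus M × IsRegular M d × d % 2 ≡ 1)
theorem9 (suc (suc (suc E))) (s≤s (s≤s (s≤s _))) n≤1500 (M , d , steinhaus , regular , d%2≡1) = by-half half-degree
  where
  open OddRegular (entry M) E d (entry-diag M steinhaus) (entry-symm M steinhaus)
    (λ v w v<w w≤D → entry-rule M steinhaus v w v<w (s<s (s≤s w≤D)))
    (entry-regular regular) (odd-%2 d d%2≡1)
  by-half : (∃ λ c → suc E ≡ c + c × d ≡ suc c × odd c ≡ false) → ⊥
  -- The half `c` is not 0 because `suc E` is positive, and not 1 because it is even.
  by-half (suc (suc K) , D≡ , d≡ , even) = by-mod-4 Inner.K-mod-4
    where
    D≡′ : suc E ≡ 4 + (K + K)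
    D≡′ = trans D≡ (cong (2 +_) (trans (+-suc K (suc K)) (cong suc (+-suc K K))))
    module Inner = Core K D≡′ d≡ even
    by-mod-4 : (∃ λ k → 2 + k * 4 ≡ K) → ⊥
    by-mod-4 (k , eq) = Inner.γ-zero⇒⊥
      (rigid Inner.γ K Inner.γ-odd Inner.γ-even 187 750 k (block<187 k K E eq D≡′ n≤1500) eq checked)
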